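{- Let $r$ and $k$ be integers with $1 \le k \le r$. There exists $n_0 = n_0(r,k)$ such that for every $n \ge n_0$ the following holds. Let $\mathcal{H}$ be an intersecting $r$-uniform hypergraph on $n$ vertices with minimum positive co-degree $\delta_{r-1}^+(\mathcal{H}) \ge k$, and suppose $\mathcal{H}$ has the maximum number of hyperedges among all intersecting $r$-uniform $n$-vertex hypergraphs with minimum positive co-degree at least $k$. Then $\mathcal{H}$ is a $k$-kernel system.
   Context: A hypergraph is intersecting if every two of its hyperedges share at least one vertex. For a non-empty $r$-uniform hypergraph $\mathcal{H}$, the minimum positive co-degree $\delta_{r-1}^+(\mathcal{H})$ is the largest integer $k$ such that every $(r-1)$-set of vertices that is contained in at least one hyperedge of $\mathcal{H}$ is contained in at least $k$ distinct hyperedges of $\mathcal{H}$; for the empty hypergraph it is defined to be $0$. Given integers $r \ge k \ge 1$, an $r$-uniform $k$-kernel system on vertex set $V$ is a hypergraph whose hyperedge set is $\{E \in \binom{V}{r} : |E \cap X| \ge k\}$ for some distinguished set $X \subseteq V$ with $|X| = 2k-1$ (the kernel). -}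

module Defs where

open import Data.Fin.Subset using (Subset; inside; outside; ∣_∣; _∩_; _⊆_; Nonempty)
open import Data.Fin.Subset.Properties
  using (_⊆?_; anySubset?; out⊆; s⊆s; ⊆-refl)
open import Data.List.Base using (List; []; _∷_; length; filter)
open import Data.List.Membership.Propositional using (_∈_; find; lose)
open import Data.List.Properties using (length-filter)
open import Data.List.Relation.Unary.Any using (any?; here)
open import Data.List.Relation.Unary.Unique.Propositional using (Unique)
open import Data.Nat.Base using (ℕ; zero; suc; _*_; _∸_; _≤_; z≤n; s≤s⁻¹)
open import Data.Nat.Properties using (_≟_; _≤?_; ≤-trans; m≤n⇒m<n∨m≡n)
open import Data.Product.Base using (∃; ∃-syntax; _×_; _,_; proj₁; proj₂)
open import Data.Sum.Base using (inj₁; inj₂)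
open import Data.Vec.Base using ([]; _∷_)
open import Function.Bundles using (_⇔_)
open import Level using (0ℓ)
open import Relation.Binary.PropositionalEquality
  using (_≡_; _≢_; refl; trans; cong)
open import Relation.Nullary
  using (Dec; yes; no; ¬?; _→-dec_; contradiction; map′; decidable-stable)
open import Relation.Unary using (Pred; Decidable)

-- The order of the list carries no meaning: nothing below depends on it.
record UniformHypergraph (n r : ℕ) : Set where
  field
    edges   : List (Subset n)
    unique  : Unique edges
    uniform : ∀ {E} → E ∈ edges → ∣ E ∣ ≡ r

open UniformHypergraph public

numEdges : ∀ {n r} → UniformHypergraph n r → ℕ
numEdges H = length (edges H)

-- E and F may coincide; this adds nothing when r ≥ 1.
Intersecting : ∀ {n r} → UniformHypergraph n r → Set
Intersecting H = ∀ {E F} → E ∈ edges H → F ∈ edges H → Nonempty (E ∩ F)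

codegree : ∀ {n r} → UniformHypergraph n r → Subset n → ℕ
codegree H S = length (filter (S ⊆?_) (edges H))

Covered : ∀ {n r} → UniformHypergraph n r → Subset n → Set
Covered H S = ∃[ E ] E ∈ edges H × S ⊆ E

PositiveCodegrees≥ : ∀ {n r} → UniformHypergraph n r → Pred ℕ 0ℓ
PositiveCodegrees≥ {n} {r} H m =
  (S : Subset n) → ∣ S ∣ ≡ r ∸ 1 → Covered H S → m ≤ codegree H S

IsGreatest : Pred ℕ 0ℓ → ℕ → Set
IsGreatest P d = P d × (∀ {m} → P m → m ≤ d)

IsMinPositiveCodegree : ∀ {n r} → UniformHypergraph n r → ℕ → Set
IsMinPositiveCodegree H d =
  (edges H ≡ [] → d ≡ 0) ×
  (edges H ≢ [] → IsGreatest (PositiveCodegrees≥ H) d)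

greatest : ∀ {P : Pred ℕ 0ℓ} → Decidable P → P 0 →
           ∀ b → (∀ {m} → P m → m ≤ b) → ∃ (IsGreatest P)
greatest P? P0 zero    bound = 0 , P0 , bound
greatest {P} P? P0 (suc b) bound with P? (suc b)
... | yes Pb = suc b , Pb , bound
... | no ¬Pb = greatest P? P0 b bound′
  where
  bound′ : ∀ {m} → P m → m ≤ b
  bound′ Pm with m≤n⇒m<n∨m≡n (bound Pm)
  ... | inj₁ m<1+b = s≤s⁻¹ m<1+b
  ... | inj₂ refl  = contradiction Pm ¬Pb

shrink : ∀ {n} (E : Subset n) → ∃[ S ] S ⊆ E × ∣ S ∣ ≡ ∣ E ∣ ∸ 1
shrink []            = [] , ⊆-refl , refl
shrink (inside  ∷ E) = outside ∷ E , out⊆ ⊆-refl , refl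
shrink (outside ∷ E) with shrink E
... | S , S⊆E , eq = outside ∷ S , s⊆s S⊆E , eq

module _ {n r} (H : UniformHypergraph n r) where

  covered? : Decidable (Covered H)
  covered? S = map′ find (λ (_ , E∈H , S⊆E) → lose E∈H S⊆E)
                    (any? (S ⊆?_) (edges H))

  positiveCodegrees≥? : Decidable (PositiveCodegrees≥ H)
  positiveCodegrees≥? m =
    map′ (λ none S → decidable-stable (Q? S) (λ ¬QS → none (S , ¬QS)))
         (λ all (S , ¬QS) → ¬QS (all S))
         (¬? (anySubset? (λ S → ¬? (Q? S))))
    where
    Q? : (S : Subset n) → Dec (∣ S ∣ ≡ r ∸ 1 → Covered H S → m ≤ codegree H S)
    Q? S = (∣ S ∣ ≟ r ∸ 1) →-dec (covered? S →-dec (m ≤? codegree H S))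

  positiveCodegrees≤ : ∀ {E m} → E ∈ edges H →
                       PositiveCodegrees≥ H m → m ≤ numEdges H
  positiveCodegrees≤ {E} E∈H all≥m with shrink E
  ... | S , S⊆E , eq =
    ≤-trans (all≥m S (trans eq (cong (_∸ 1) (uniform H E∈H))) (E , E∈H , S⊆E))
            (length-filter (S ⊆?_) (edges H))

minPositiveCodegree : ∀ {n r} (H : UniformHypergraph n r) →
                      ∃ (IsMinPositiveCodegree H)
minPositiveCodegree record { edges = [] } =
  0 , (λ _ → refl) , λ ne → contradiction refl ne
minPositiveCodegree H@record { edges = _ ∷ _ } =
  let d , isGreatest = greatest (positiveCodegrees≥? H) (λ _ _ _ → z≤n)
                                (numEdges H) (positiveCodegrees≤ H (here refl))
  in d , (λ ()) , λ _ → isGreatest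

δ⁺ : ∀ {n r} → UniformHypergraph n r → ℕ
δ⁺ H = proj₁ (minPositiveCodegree H)

δ⁺-correct : ∀ {n r} (H : UniformHypergraph n r) → IsMinPositiveCodegree H (δ⁺ H)
δ⁺-correct H = proj₂ (minPositiveCodegree H)

IsKernelSystem : ∀ {n r} → ℕ → UniformHypergraph n r → Set
IsKernelSystem {n} {r} k H =
  ∃[ X ] ∣ X ∣ ≡ 2 * k ∸ 1 ×
         ((E : Subset n) → E ∈ edges H ⇔ (∣ E ∣ ≡ r × k ≤ ∣ E ∩ X ∣))

{-# OPTIONS --safe #-}
-- Call a k-set T heavy if, for every vertex set Y of bounded size, some edge
-- contains T and meets Y only inside T.  Exchanging a vertex v of an edge E
-- for the at least k available replacements shows that no set of fewer than k
-- vertices meets every edge.  Branching over edges missed by the current set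
-- therefore bounds the number of edges by O(n^(r-k-1)) unless a heavy k-set
-- exists, whereas a kernel system has at least of the order of n^(r-k) edges.
-- Heavy sets pairwise intersect, and exchanging vertices preserves heaviness
-- up to a loss in the bound on Y.  This yields two heavy sets meeting in a
-- single vertex.  Their union X has 2k-1 vertices, and an edge F with
-- |F ∩ X| < k could be made disjoint from a heavy set by further exchanges.
-- So the hypergraph lies in the kernel system of X, and maximality gives
-- equality.
module Submission where

open import Defs
open import Data.Bool.Properties using () renaming (_≟_ to _≟ᵇ_)
open import Data.Empty using (⊥-elim)
open import Data.Fin.Base using (Fin; zero; suc)
open import Data.Fin.Properties using () renaming (suc-injective to Fin-suc-injective; _≟_ to _≟ᶠ_; any? to anyFin?)
open import Data.Fin.Subset
open import Data.Fin.Subset.Properties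
open import Data.List.Base using (List; []; _∷_; _++_; length; map; filter)
open import Data.List.Properties using (length-map; length-++)
open import Data.List.Membership.Propositional using (find; lose) renaming (_∈_ to _∈ₗ_)
open import Data.List.Membership.Propositional.Properties
  using (∈-map⁺; ∈-map⁻; ∈-++⁺ˡ; ∈-++⁺ʳ; ∈-++⁻; ∈-∃++; ∈-filter⁺; ∈-filter⁻)
open import Data.List.Relation.Unary.All as All using (All; []; _∷_)
open import Data.List.Relation.Unary.AllPairs using ([]; _∷_)
open import Data.List.Relation.Unary.Any using (any?; here; there)
open import Data.List.Relation.Unary.Unique.Propositional using (Unique)
import Data.List.Relation.Unary.Unique.Propositional.Properties as Unique
open import Data.Nat.DivMod
open import Data.Nat.Combinatorics using (_C_; nCk+nC[k+1]≡[n+1]C[k+1]; k>n⇒nCk≡0)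
open import Data.Nat hiding (∣_-_∣)
open import Data.Nat.Properties
open import Data.Product using (∃-syntax; _×_; _,_; proj₁; proj₂)
open import Data.Sum using (_⊎_; inj₁; inj₂; [_,_]′)
open import Data.Vec.Base using ([]; _∷_; here; there)
open import Data.Vec.Properties using (∷-injectiveʳ; ≡-dec)
open import Function.Base using (_∘_)
open import Function.Bundles using (mk⇔)
open import Relation.Binary.PropositionalEquality
open import Relation.Nullary

private
  variable
    n r : ℕ
    p q S T E : Subset n
    v w x y : Fin n

-- Adding and removing single vertices, with cardinalities.

infixl 5 _⊕_

_⊕_ : Subset n → Fin n → Subset n
p ⊕ w = p ∪ ⁅ w ⁆

∈-⊕ˡ : x ∈ p → x ∈ p ⊕ w
∈-⊕ˡ = p⊆p∪q _

∈-⊕ʳ : ∀ (p : Subset n) w → w ∈ p ⊕ w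
∈-⊕ʳ p w = q⊆p∪q p ⁅ w ⁆ (x∈⁅x⁆ w)

∈-⊕⁻ : x ∈ p ⊕ w → x ∈ p ⊎ x ≡ w
∈-⊕⁻ {p = p} {w = w} x∈ with x∈p∪q⁻ p ⁅ w ⁆ x∈
... | inj₁ x∈p = inj₁ x∈p
... | inj₂ x∈w = inj₂ (x∈⁅y⁆⇒x≡y w x∈w)

⊕-least : p ⊆ q → w ∈ q → p ⊕ w ⊆ q
⊕-least p⊆q w∈q x∈ with ∈-⊕⁻ x∈
... | inj₁ x∈p  = p⊆q x∈p
... | inj₂ refl = w∈q

∈-─⁻ : x ∈ p - y → x ∈ p
∈-─⁻ {p = p} {y = y} = p─q⊆p p ⁅ y ⁆

∈-─⇒≢ : x ∈ p - y → x ≢ y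
∈-─⇒≢ {p = _ ∷ _} {y = zero}  (there x∈) ()
∈-─⇒≢ {p = _ ∷ _} {y = suc y} (there x∈) refl = ∈-─⇒≢ x∈ refl

∣⊕∣ : ∀ (p : Subset n) {w} → w ∉ p → ∣ p ⊕ w ∣ ≡ suc ∣ p ∣
∣⊕∣ (inside  ∷ p) {zero}  w∉ = contradiction here w∉
∣⊕∣ (outside ∷ p) {zero}  w∉ = cong (suc ∘ ∣_∣) (∪-identityʳ p)
∣⊕∣ (inside  ∷ p) {suc w} w∉ = cong suc (∣⊕∣ p (w∉ ∘ there))
∣⊕∣ (outside ∷ p) {suc w} w∉ = ∣⊕∣ p (w∉ ∘ there)

∣-∣ : v ∈ p → suc ∣ p - v ∣ ≡ ∣ p ∣
∣-∣ {p = _ ∷ p}       here       = cong (suc ∘ ∣_∣) (p─⊥≡p p)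
∣-∣ {p = inside ∷ _}  (there v∈) = cong suc (∣-∣ v∈)
∣-∣ {p = outside ∷ _} (there v∈) = ∣-∣ v∈

∣swap∣ : v ∈ p → w ∉ p - v → ∣ p - v ⊕ w ∣ ≡ ∣ p ∣
∣swap∣ v∈ w∉ = trans (∣⊕∣ _ w∉) (∣-∣ v∈)

∣∪∣+∣∩∣ : ∀ (p q : Subset n) → ∣ p ∪ q ∣ + ∣ p ∩ q ∣ ≡ ∣ p ∣ + ∣ q ∣
∣∪∣+∣∩∣ []            []            = refl
∣∪∣+∣∩∣ (outside ∷ p) (outside ∷ q) = ∣∪∣+∣∩∣ p q
∣∪∣+∣∩∣ (outside ∷ p) (inside  ∷ q) =
  trans (cong suc (∣∪∣+∣∩∣ p q)) (sym (+-suc ∣ p ∣ ∣ q ∣))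
∣∪∣+∣∩∣ (inside  ∷ p) (outside ∷ q) = cong suc (∣∪∣+∣∩∣ p q)
∣∪∣+∣∩∣ (inside  ∷ p) (inside  ∷ q) = cong suc
  (trans (+-suc ∣ p ∪ q ∣ ∣ p ∩ q ∣) (trans (cong suc (∣∪∣+∣∩∣ p q)) (sym (+-suc ∣ p ∣ ∣ q ∣))))

∣∪∣≤ : ∀ (p q : Subset n) → ∣ p ∪ q ∣ ≤ ∣ p ∣ + ∣ q ∣
∣∪∣≤ p q = ≤-trans (m≤m+n _ _) (≤-reflexive (∣∪∣+∣∩∣ p q))

⊈⇒∃∉ : ¬ (q ⊆ p) → ∃[ x ] x ∈ q × x ∉ p
⊈⇒∃∉ {q = q} {p = p} q⊈p with nonempty? (q ∩ ∁ p)
... | yes (x , x∈) = let x∈q , x∈∁p = x∈p∩q⁻ q (∁ p) x∈ in x , x∈q , x∈∁p⇒x∉p x∈∁p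
... | no empty     = contradiction
  (λ {x} x∈q → decidable-stable (x ∈? p)
    λ x∉p → empty (x , x∈p∩q⁺ (x∈q , x∉p⇒x∈∁p x∉p)))
  q⊈p

∣∣<⇒∃∉ : ∣ p ∣ < ∣ q ∣ → ∃[ x ] x ∈ q × x ∉ p
∣∣<⇒∃∉ p<q = ⊈⇒∃∉ (λ q⊆p → <⇒≱ p<q (p⊆q⇒∣p∣≤∣q∣ q⊆p))

⊆∧∣∣≡⇒≡ : p ⊆ q → ∣ p ∣ ≡ ∣ q ∣ → p ≡ q
⊆∧∣∣≡⇒≡ {p = p} {q = q} p⊆q eq with q ⊆? p
... | yes q⊆p = ⊆-antisym p⊆q q⊆p
... | no  q⊈p = contradiction eq (<⇒≢ (p⊂q⇒∣p∣<∣q∣ (p⊆q , ⊈⇒∃∉ q⊈p)))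

∈⇒∣∣>0 : x ∈ p → 0 < ∣ p ∣
∈⇒∣∣>0 x∈p = ≤-trans z<s (≤-reflexive (∣-∣ x∈p))

-- Subsets as duplicate-free lists.

elements : Subset n → List (Fin n)
elements []            = []
elements (inside  ∷ p) = zero ∷ map suc (elements p)
elements (outside ∷ p) = map suc (elements p)

length-elements : ∀ (p : Subset n) → length (elements p) ≡ ∣ p ∣
length-elements []            = refl
length-elements (inside  ∷ p) = cong suc (trans (length-map suc (elements p)) (length-elements p))
length-elements (outside ∷ p) = trans (length-map suc (elements p)) (length-elements p)

∈-elements⁺ : x ∈ p → x ∈ₗ elements p
∈-elements⁺ {p = _ ∷ _}       here       = here refl
∈-elements⁺ {p = inside ∷ _}  (there x∈) = there (∈-map⁺ suc (∈-elements⁺ x∈))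
∈-elements⁺ {p = outside ∷ _} (there x∈) = ∈-map⁺ suc (∈-elements⁺ x∈)

∈-elements⁻ : ∀ (p : Subset n) → x ∈ₗ elements p → x ∈ p
∈-elements⁻ (inside ∷ p) (here refl) = here
∈-elements⁻ (inside ∷ p) (there x∈) with ∈-map⁻ suc x∈
... | _ , y∈ , refl = there (∈-elements⁻ p y∈)
∈-elements⁻ (outside ∷ p) x∈ with ∈-map⁻ suc x∈
... | _ , y∈ , refl = there (∈-elements⁻ p y∈)

elements-unique : ∀ (p : Subset n) → Unique (elements p)
elements-unique []            = []
elements-unique (inside  ∷ p) =
  All.tabulate (λ x∈ 0≡x → case-suc (∈-map⁻ suc x∈) 0≡x)
  ∷ Unique.map⁺ Fin-suc-injective (elements-unique p)
  where
  case-suc : ∀ {x} → (∃[ y ] y ∈ₗ elements p × x ≡ suc y) → zero ≢ x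
  case-suc (_ , _ , refl) ()
elements-unique (outside ∷ p) = Unique.map⁺ Fin-suc-injective (elements-unique p)

-- The pigeonhole principle in list form; codegrees and edge counts are compared through it.
unique⊆⇒length≤ : ∀ {A : Set} {xs ys : List A} → Unique xs →
                  (∀ {x} → x ∈ₗ xs → x ∈ₗ ys) → length xs ≤ length ys
unique⊆⇒length≤ {xs = []}     []           xs⊆ys = z≤n
unique⊆⇒length≤ {xs = x ∷ xs} (x∉xs ∷ uxs) xs⊆ys with ∈-∃++ (xs⊆ys (here refl))
... | as , bs , refl = ≤-trans (s≤s (unique⊆⇒length≤ uxs sub)) (≤-reflexive eq)
  where
  sub : ∀ {y} → y ∈ₗ xs → y ∈ₗ as ++ bs
  sub y∈ with ∈-++⁻ as (xs⊆ys (there y∈))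
  ... | inj₁ y∈as         = ∈-++⁺ˡ y∈as
  ... | inj₂ (here refl)  = contradiction refl (All.lookup x∉xs y∈)
  ... | inj₂ (there y∈bs) = ∈-++⁺ʳ as y∈bs

  eq : suc (length (as ++ bs)) ≡ length (as ++ x ∷ bs)
  eq = trans (cong suc (length-++ as)) (trans (sym (+-suc _ _)) (sym (length-++ as)))


-- Effect of exchanges on intersections.

-- The decreasing measure behind the descents by exchange below.
∣exchange-∩∣< : v ∈ p → v ∈ q → w ∉ q → ∣ (p - v ⊕ w) ∩ q ∣ < ∣ p ∩ q ∣
∣exchange-∩∣< {v = v} {p = p} {q = q} {w = w} v∈p v∈q w∉q =
  p⊂q⇒∣p∣<∣q∣ (sub , v , x∈p∩q⁺ (v∈p , v∈q) , v∉)
  where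
  sub : (p - v ⊕ w) ∩ q ⊆ p ∩ q
  sub x∈ with x∈p∩q⁻ _ q x∈
  ... | x∈⊕ , x∈q with ∈-⊕⁻ x∈⊕
  ...   | inj₁ x∈-  = x∈p∩q⁺ (∈-─⁻ x∈- , x∈q)
  ...   | inj₂ refl = contradiction x∈q w∉q

  v∉ : v ∉ (p - v ⊕ w) ∩ q
  v∉ v∈ with ∈-⊕⁻ (proj₁ (x∈p∩q⁻ _ q v∈))
  ... | inj₁ v∈-  = ∈-─⇒≢ v∈- refl
  ... | inj₂ refl = w∉q v∈q

∣⊕∣+ : ∀ {i m} → ∣ p ∣ + suc i ≡ m → w ∉ p → ∣ p ⊕ w ∣ + i ≡ m
∣⊕∣+ {p = p} {i = i} eq w∉p =
  trans (cong (_+ i) (∣⊕∣ p w∉p)) (trans (sym (+-suc ∣ p ∣ i)) eq)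

-- Pointwise form of `p ∩ q ≡ ⁅ v ⁆`, which lets the membership facts be used directly.
record MeetOnlyIn (v : Fin n) (p q : Subset n) : Set where
  constructor meetOnlyIn
  field
    ∈ˡ   : v ∈ p
    ∈ʳ   : v ∈ q
    only : ∀ {x} → x ∈ p → x ∈ q → x ≡ v

open MeetOnlyIn

meetOnlyIn-sym : MeetOnlyIn v p q → MeetOnlyIn v q p
meetOnlyIn-sym m = meetOnlyIn (∈ʳ m) (∈ˡ m) (λ x∈q x∈p → only m x∈p x∈q)

meetOnlyIn-∉ : MeetOnlyIn v p q → w ∈ q → w ∉ p - v
meetOnlyIn-∉ m w∈q w∈ = ∈-─⇒≢ w∈ (only m (∈-─⁻ w∈) w∈q)

meetOnlyIn-exchange : MeetOnlyIn v p q → w ∈ q → MeetOnlyIn w (p - v ⊕ w) q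
meetOnlyIn-exchange {v = v} {p = p} {q = q} {w = w} m w∈q = meetOnlyIn (∈-⊕ʳ (p - v) w) w∈q unique′
  where
  unique′ : ∀ {x} → x ∈ p - v ⊕ w → x ∈ q → x ≡ w
  unique′ x∈ x∈q with ∈-⊕⁻ x∈
  ... | inj₁ x∈-  = contradiction x∈- (meetOnlyIn-∉ m x∈q)
  ... | inj₂ x≡w  = x≡w

exchange-⊆ : p ⊆ S → w ∈ S → p - v ⊕ w ⊆ S
exchange-⊆ p⊆S = ⊕-least (λ x∈ → p⊆S (∈-─⁻ x∈))

-- Each exchange step of heavy-exchange turns Heavy (r + r * m) into Heavy m;
-- level r m t leaves room for t such steps.
level : ℕ → ℕ → ℕ → ℕ
level r m zero    = m
level r m (suc t) = m + (r + r * level r m t)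

m≤level : ∀ r m t → m ≤ level r m t
m≤level r m zero    = ≤-refl
m≤level r m (suc t) = m≤m+n m _

-- Exchanges inside the hypergraph and transversals.

module _ {n r k : ℕ} (k≤r : k ≤ r) (H : UniformHypergraph n r)
         (intersecting : Intersecting H) (codegrees : PositiveCodegrees≥ H k) where

  -- The covered set `E - v` lies in at least k edges, each of the form `E - v ⊕ w` with its own w.
  -- If every such w lay in Z, there would be at most |Z| < k of them. The new vertex may be v
  -- itself when v lies outside Z.
  exchange : ∀ {E v Z} → E ∈ₗ edges H → v ∈ E → ∣ Z ∣ < k →
             ∃[ w ] w ∉ Z × w ∉ E - v × E - v ⊕ w ∈ₗ edges H
  exchange {E} {v} {Z} E∈H v∈E Z<k
    with anyFin? (λ w → ¬? (w ∈? Z) ×-dec ¬? (w ∈? (E - v))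
                        ×-dec any? (≡-dec _≟ᵇ_ (E - v ⊕ w)) (edges H))
  ... | yes (w , found) = w , found
  ... | no  none        = contradiction k≤∣Z∣ (<⇒≱ Z<k)
    where
    candidates : List (Subset n)
    candidates = map (E - v ⊕_) (elements Z)

    sub : ∀ {F} → F ∈ₗ filter ((E - v) ⊆?_) (edges H) → F ∈ₗ candidates
    sub {F} F∈ with ∈-filter⁻ ((E - v) ⊆?_) F∈
    ... | F∈H , E-v⊆F
      with ∣∣<⇒∃∉ (≤-reflexive (trans (∣-∣ v∈E) (trans (uniform H E∈H) (sym (uniform H F∈H)))))
    ...   | w , w∈F , w∉E-v
      with ⊆∧∣∣≡⇒≡ (⊕-least E-v⊆F w∈F)
             (trans (∣swap∣ v∈E w∉E-v) (trans (uniform H E∈H) (sym (uniform H F∈H))))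
    ...     | refl = ∈-map⁺ (E - v ⊕_) (∈-elements⁺
              (decidable-stable (w ∈? Z) λ w∉Z → none (w , w∉Z , w∉E-v , F∈H)))

    k≤∣Z∣ : k ≤ ∣ Z ∣
    k≤∣Z∣ = begin
      k                                          ≤⟨ codegrees (E - v) size (E , E∈H , λ x∈ → ∈-─⁻ x∈) ⟩
      codegree H (E - v)                         ≤⟨ unique⊆⇒length≤ (Unique.filter⁺ ((E - v) ⊆?_) (unique H)) sub ⟩
      length candidates                          ≡⟨ length-map _ (elements Z) ⟩
      length (elements Z)                        ≡⟨ length-elements Z ⟩
      ∣ Z ∣                                      ∎
      where
      open ≤-Reasoning
      size : ∣ E - v ∣ ≡ r ∸ 1
      size = cong pred (trans (∣-∣ v∈E) (uniform H E∈H))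

  -- As S has fewer than k vertices, a vertex of E in S can always be exchanged for one outside S.
  -- This shrinks `E ∩ S`, and t drives the recursion. In other words, a transversal has at least k
  -- vertices.
  avoiding-edge : ∀ {S} → ∣ S ∣ < k → ∀ t {E} → E ∈ₗ edges H → ∣ E ∩ S ∣ ≤ t →
                  ∃[ F ] F ∈ₗ edges H × Empty (F ∩ S)
  avoiding-edge {S} S<k t {E} E∈H E∩S≤t with nonempty? (E ∩ S)
  ... | no empty = E , E∈H , empty
  ... | yes (v , v∈) with x∈p∩q⁻ E S v∈
  ...   | v∈E , v∈S with exchange E∈H v∈E S<k
  ...     | w , w∉S , _ , G∈H with ∣exchange-∩∣< v∈E v∈S w∉S
  avoiding-edge S<k zero    E∈H E∩S≤t | yes _ | _ | _ , _ , _ , G∈H | lt =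
    contradiction (<-≤-trans lt E∩S≤t) λ ()
  avoiding-edge S<k (suc t) E∈H E∩S≤t | yes _ | _ | _ , _ , _ , G∈H | lt =
    avoiding-edge S<k t G∈H (s≤s⁻¹ (<-≤-trans lt E∩S≤t))

  Transversal : Subset n → Set
  Transversal T = ∀ {E} → E ∈ₗ edges H → Nonempty (E ∩ T)

  -- Every replacement of v in E must meet T again, so it lies in T; as there
  -- are k = ∣ T ∣ replacements, all vertices of T occur.
  transversal-exchange : ∀ {T E v w} → ∣ T ∣ ≡ k → Transversal T → E ∈ₗ edges H →
                         MeetOnlyIn v E T → w ∈ T → E - v ⊕ w ∈ₗ edges H
  transversal-exchange {T} {E} {v} {w} ∣T∣≡k transversal E∈H m w∈T
    with exchange {Z = T - w} E∈H (∈ˡ m) (≤-reflexive (trans (∣-∣ w∈T) ∣T∣≡k))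
  ... | x , x∉T-w , _ , G∈H with transversal G∈H
  ...   | y , y∈ with x∈p∩q⁻ (E - v ⊕ x) T y∈
  ...     | y∈G , y∈T with ∈-⊕⁻ y∈G
  ...       | inj₁ y∈E-v = contradiction y∈E-v (meetOnlyIn-∉ m y∈T)
  ...       | inj₂ refl with y ≟ᶠ w
  ...         | yes refl = G∈H
  ...         | no  y≢w  = contradiction (x∈p∧x≢y⇒x∈p-y y∈T y≢w) x∉T-w

  -- Heavy sets.

  EdgeAvoiding : Subset n → Subset n → Set
  EdgeAvoiding T Y = ∃[ E ] E ∈ₗ edges H × T ⊆ E × E ∩ Y ⊆ T

  edgeAvoiding-anti : ∀ {T Y Z} → Y ⊆ Z → EdgeAvoiding T Z → EdgeAvoiding T Y
  edgeAvoiding-anti {Y = Y} Y⊆Z (E , E∈H , T⊆E , E∩Z⊆T) = E , E∈H , T⊆E , λ x∈ →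
    let x∈E , x∈Y = x∈p∩q⁻ E Y x∈ in E∩Z⊆T (x∈p∩q⁺ (x∈E , Y⊆Z x∈Y))

  edgeAvoiding? : ∀ T Y → Dec (EdgeAvoiding T Y)
  edgeAvoiding? T Y = map′ find (λ (_ , E∈H , found) → lose E∈H found)
    (any? (λ E → (T ⊆? E) ×-dec (E ∩ Y ⊆? T)) (edges H))

  -- Equivalently, the link of T, consisting of all E minus T for edges E containing T, has no
  -- vertex cover of size at most m.
  Heavy : ℕ → Subset n → Set
  Heavy m T = ∀ Y → ∣ Y ∣ ≤ m → EdgeAvoiding T Y

  heavy-anti : ∀ {m m′ T} → m ≤ m′ → Heavy m′ T → Heavy m T
  heavy-anti m≤m′ heavy Y Y≤m = heavy Y (≤-trans Y≤m m≤m′)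

  Blocked : ℕ → Subset n → Set
  Blocked m T = ∃[ Y ] ∣ Y ∣ ≤ m × ¬ EdgeAvoiding T Y

  heavy⊎blocked : ∀ m T → Heavy m T ⊎ Blocked m T
  heavy⊎blocked m T
    with anySubset? (λ Y → (∣ Y ∣ ≤? m) ×-dec ¬? (edgeAvoiding? T Y))
  ... | yes blocked = inj₂ blocked
  ... | no  none    = inj₁ λ Y Y≤m →
    decidable-stable (edgeAvoiding? T Y) λ ¬avoiding → none (Y , Y≤m , ¬avoiding)

  -- `EdgeAvoiding` is antitone in Y, so the union of the individual blockers blocks all the sets at
  -- once, at the price of a factor `length ws`.
  someHeavy⊎allBlocked : ∀ m (f : Fin n → Subset n) (ws : List (Fin n)) →
    (∃[ w ] w ∈ₗ ws × Heavy m (f w)) ⊎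
    (∃[ Y ] ∣ Y ∣ ≤ length ws * m × (∀ {w} → w ∈ₗ ws → ¬ EdgeAvoiding (f w) Y))
  someHeavy⊎allBlocked m f [] = inj₂ (⊥ , ≤-reflexive (∣⊥∣≡0 n) , λ ())
  someHeavy⊎allBlocked m f (w ∷ ws) with heavy⊎blocked m (f w)
  ... | inj₁ heavy = inj₁ (w , here refl , heavy)
  ... | inj₂ (Y , Y≤ , blocked) with someHeavy⊎allBlocked m f ws
  ...   | inj₁ (u , u∈ , heavy) = inj₁ (u , there u∈ , heavy)
  ...   | inj₂ (Z , Z≤ , blocked′) =
    inj₂ (Y ∪ Z , ≤-trans (∣∪∣≤ Y Z) (+-mono-≤ Y≤ Z≤) , λ where
      (here refl) → blocked ∘ edgeAvoiding-anti (p⊆p∪q Z)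
      (there u∈)  → blocked′ u∈ ∘ edgeAvoiding-anti (q⊆p∪q Y Z))

  -- Taking Y to be F itself gives an edge through T that meets F only inside T, and intersection
  -- makes this meeting nonempty.
  heavy⇒transversal : ∀ {m T} → r ≤ m → Heavy m T → Transversal T
  heavy⇒transversal r≤m heavy {F} F∈H
    with heavy F (≤-trans (≤-reflexive (uniform H F∈H)) r≤m)
  ... | E , E∈H , T⊆E , E∩F⊆T with intersecting E∈H F∈H
  ...   | x , x∈ = x , x∈p∩q⁺ (proj₂ (x∈p∩q⁻ E F x∈) , E∩F⊆T x∈)

  -- An edge through T that meets `T′` only inside T still has to meet the transversal `T′`.
  heavy-meet : ∀ {m T T′} → r ≤ m → ∣ T′ ∣ ≡ k → Heavy m T → Heavy m T′ →
               ∃[ v ] v ∈ T × v ∈ T′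
  heavy-meet {T′ = T′} r≤m ∣T′∣≡k heavy heavy′
    with heavy T′ (≤-trans (≤-reflexive ∣T′∣≡k) (≤-trans k≤r r≤m))
  ... | E , E∈H , T⊆E , E∩T′⊆T with heavy⇒transversal r≤m heavy′ E∈H
  ...   | x , x∈ = x , E∩T′⊆T x∈ , proj₂ (x∈p∩q⁻ E T′ x∈)

  -- Since T - v is too small to meet all edges, some F misses it, and every
  -- replacement of v in an edge E ⊇ T lies in F.  If all w ∈ F outside T′ were
  -- blocked, an E avoiding all these blockers at once would have its
  -- replacements confined to T′ - u, which has fewer than k vertices.
  heavy-exchange : ∀ {m T T′ u v} → ∣ T ∣ ≡ k → ∣ T′ ∣ ≡ k →
                   v ∈ T → u ∈ T → u ∈ T′ → u ≢ v → Heavy (r + r * m) T →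
                   ∃[ w ] w ∉ T′ × w ∉ T - v × Heavy m (T - v ⊕ w)
  heavy-exchange {m} {T} {T′} {u} {v} ∣T∣≡k ∣T′∣≡k v∈T u∈T u∈T′ u≢v heavy
    with heavy ⊥ (≤-trans (≤-reflexive (∣⊥∣≡0 n)) z≤n)
  ... | E₀ , E₀∈H , _
    with avoiding-edge (≤-reflexive (trans (∣-∣ v∈T) ∣T∣≡k)) _ E₀∈H ≤-refl
  ... | F , F∈H , F∩T-v≡∅
    with someHeavy⊎allBlocked m (T - v ⊕_) (elements (F ∩ ∁ T′))
  ... | inj₁ (w , w∈ , heavy-w) =
    let w∈F , w∈∁T′ = x∈p∩q⁻ F (∁ T′) (∈-elements⁻ (F ∩ ∁ T′) w∈)
    in w , x∈∁p⇒x∉p w∈∁T′ , (λ w∈T-v → F∩T-v≡∅ (w , x∈p∩q⁺ (w∈F , w∈T-v))) , heavy-w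
  ... | inj₂ (Y , Y≤ , blocked)
    with heavy (F ∪ Y) (begin
      ∣ F ∪ Y ∣                                ≤⟨ ∣∪∣≤ F Y ⟩
      ∣ F ∣ + ∣ Y ∣                            ≡⟨ cong (_+ ∣ Y ∣) (uniform H F∈H) ⟩
      r + ∣ Y ∣                                ≤⟨ +-monoʳ-≤ r Y≤ ⟩
      r + length (elements (F ∩ ∁ T′)) * m     ≡⟨ cong (λ l → r + l * m) (length-elements (F ∩ ∁ T′)) ⟩
      r + ∣ F ∩ ∁ T′ ∣ * m                     ≤⟨ +-monoʳ-≤ r (*-monoˡ-≤ m (∣p∩q∣≤∣p∣ F (∁ T′))) ⟩
      r + ∣ F ∣ * m                            ≡⟨ cong (λ l → r + l * m) (uniform H F∈H) ⟩
      r + r * m                                ∎)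
    where open ≤-Reasoning
  ... | E , E∈H , T⊆E , E∩[F∪Y]⊆T
    with exchange {Z = T′ - u} E∈H (T⊆E v∈T) (≤-reflexive (trans (∣-∣ u∈T′) ∣T′∣≡k))
  ... | x , x∉T′-u , x∉E-v , G∈H =
    contradiction avoiding (blocked (∈-elements⁺ (x∈p∩q⁺ (x∈F , x∉p⇒x∈∁p x∉T′))))
    where
    E-v∩[F∪Y]⊆T-v : ∀ {y} → y ∈ E - v → y ∈ F ∪ Y → y ∈ T - v
    E-v∩[F∪Y]⊆T-v y∈E-v y∈F∪Y =
      x∈p∧x≢y⇒x∈p-y (E∩[F∪Y]⊆T (x∈p∩q⁺ (∈-─⁻ y∈E-v , y∈F∪Y))) (∈-─⇒≢ y∈E-v)

    T-v⊆E-v : T - v ⊆ E - v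
    T-v⊆E-v y∈ = x∈p∧x≢y⇒x∈p-y (T⊆E (∈-─⁻ y∈)) (∈-─⇒≢ y∈)

    x∈F : x ∈ F
    x∈F with intersecting G∈H F∈H
    ... | y , y∈ with x∈p∩q⁻ _ F y∈
    ...   | y∈G , y∈F with ∈-⊕⁻ y∈G
    ...     | inj₁ y∈E-v = ⊥-elim (F∩T-v≡∅
                (y , x∈p∩q⁺ (y∈F , E-v∩[F∪Y]⊆T-v y∈E-v (p⊆p∪q Y y∈F))))
    ...     | inj₂ refl  = y∈F

    -- Only `T′ - u` was excluded in the exchange. The vertex u is ruled out because u ≠ v places it
    -- in `T - v`, hence in `E - v`, which x avoids.
    x∉T′ : x ∉ T′
    x∉T′ x∈T′ with x ≟ᶠ u
    ... | yes refl = x∉E-v (T-v⊆E-v (x∈p∧x≢y⇒x∈p-y u∈T u≢v))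
    ... | no  x≢u  = x∉T′-u (x∈p∧x≢y⇒x∈p-y x∈T′ x≢u)

    T-v⊕x⊆G : T - v ⊕ x ⊆ E - v ⊕ x
    T-v⊕x⊆G = ⊕-least (λ y∈ → ∈-⊕ˡ (T-v⊆E-v y∈)) (∈-⊕ʳ (E - v) x)

    G∩Y⊆T-v⊕x : (E - v ⊕ x) ∩ Y ⊆ T - v ⊕ x
    G∩Y⊆T-v⊕x y∈ with x∈p∩q⁻ _ Y y∈
    ... | y∈G , y∈Y with ∈-⊕⁻ y∈G
    ...   | inj₁ y∈E-v = ∈-⊕ˡ (E-v∩[F∪Y]⊆T-v y∈E-v (q⊆p∪q F Y y∈Y))
    ...   | inj₂ refl  = ∈-⊕ʳ (T - v) x

    avoiding : EdgeAvoiding (T - v ⊕ x) Y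
    avoiding = E - v ⊕ x , G∈H , T-v⊕x⊆G , G∩Y⊆T-v⊕x

  -- An edge through T that avoids `T′` outside T meets `T′` in v alone, so `transversal-exchange`
  -- may replace v by any w in `T′`. The extra k in the bound pays for adding `T′` to Y.
  heavy-shift : ∀ {m T T′ v w} → ∣ T′ ∣ ≡ k → Transversal T′ → MeetOnlyIn v T T′ →
                w ∈ T′ → Heavy (m + k) T → Heavy m (T - v ⊕ w)
  heavy-shift {m} {T} {T′} {v} {w} ∣T′∣≡k transversal meet w∈T′ heavy Y Y≤m
    with heavy (Y ∪ T′) (≤-trans (∣∪∣≤ Y T′) (+-mono-≤ Y≤m (≤-reflexive ∣T′∣≡k)))
  ... | E , E∈H , T⊆E , E∩[Y∪T′]⊆T =
    E - v ⊕ w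
    , transversal-exchange ∣T′∣≡k transversal E∈H meet′ w∈T′
    , ⊕-least (λ y∈ → ∈-⊕ˡ (x∈p∧x≢y⇒x∈p-y (T⊆E (∈-─⁻ y∈)) (∈-─⇒≢ y∈))) (∈-⊕ʳ (E - v) w)
    , G∩Y⊆
    where
    meet′ : MeetOnlyIn v E T′
    meet′ = meetOnlyIn (T⊆E (∈ˡ meet)) (∈ʳ meet) λ x∈E x∈T′ →
      only meet (E∩[Y∪T′]⊆T (x∈p∩q⁺ (x∈E , q⊆p∪q Y T′ x∈T′))) x∈T′

    G∩Y⊆ : (E - v ⊕ w) ∩ Y ⊆ T - v ⊕ w
    G∩Y⊆ y∈ with x∈p∩q⁻ _ Y y∈
    ... | y∈G , y∈Y with ∈-⊕⁻ y∈G
    ...   | inj₂ refl  = ∈-⊕ʳ (T - v) w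
    ...   | inj₁ y∈E-v = ∈-⊕ˡ (x∈p∧x≢y⇒x∈p-y
              (E∩[Y∪T′]⊆T (x∈p∩q⁺ (∈-─⁻ y∈E-v , p⊆p∪q T′ y∈Y))) (∈-─⇒≢ y∈E-v))

  -- While T and `T′` share a second vertex u besides v, `heavy-exchange` moves v out of `T′`, which
  -- shrinks the intersection. Heavy sets always meet, so the descent stops at exactly one common
  -- vertex.
  heavy-meetingOnce : ∀ {m T′} → r ≤ m → ∣ T′ ∣ ≡ k → Heavy m T′ →
                      ∀ t {T} → ∣ T ∣ ≡ k → ∣ T ∩ T′ ∣ ≤ t → Heavy (level r m t) T →
                      ∃[ S ] ∃[ v ] ∣ S ∣ ≡ k × Heavy m S × MeetOnlyIn v S T′
  heavy-meetingOnce {m} {T′} r≤m ∣T′∣≡k heavy′ t {T} ∣T∣≡k T∩T′≤t heavy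
    with heavy-meet r≤m ∣T′∣≡k (heavy-anti (m≤level r m t) heavy) heavy′
  heavy-meetingOnce r≤m ∣T′∣≡k heavy′ zero ∣T∣≡k T∩T′≤0 heavy
    | v , v∈T , v∈T′ = contradiction T∩T′≤0 (<⇒≱ (∈⇒∣∣>0 (x∈p∩q⁺ (v∈T , v∈T′))))
  heavy-meetingOnce {m} {T′} r≤m ∣T′∣≡k heavy′ (suc t) {T} ∣T∣≡k T∩T′≤ heavy
    | v , v∈T , v∈T′ with nonempty? (T ∩ T′ - v)
  ... | no empty = T , v , ∣T∣≡k , heavy-anti (m≤level r m (suc t)) heavy ,
    meetOnlyIn v∈T v∈T′ λ {x} x∈T x∈T′ → decidable-stable (x ≟ᶠ v) λ x≢v →
      empty (x , x∈p∧x≢y⇒x∈p-y (x∈p∩q⁺ (x∈T , x∈T′)) x≢v)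
  ... | yes (u , u∈) with x∈p∩q⁻ T T′ (∈-─⁻ u∈)
  ...   | u∈T , u∈T′
    with heavy-exchange ∣T∣≡k ∣T′∣≡k v∈T u∈T u∈T′ (∈-─⇒≢ u∈) (heavy-anti (m≤n+m _ m) heavy)
  ...   | w , w∉T′ , w∉T-v , heavy-w =
    heavy-meetingOnce r≤m ∣T′∣≡k heavy′ t (trans (∣swap∣ v∈T w∉T-v) ∣T∣≡k)
      (s≤s⁻¹ (<-≤-trans (∣exchange-∩∣< v∈T v∈T′ w∉T′) T∩T′≤)) heavy-w

  -- If F meets T in a, moving the common vertex to a and then from a to some
  -- b ∈ S′ outside F makes T ∩ F smaller; if there is no such b, then S′ ⊆ F ∩ X.
  edge-meets-kernel : ∀ j {T T′ v X F} → ∣ T ∣ ≡ k → ∣ T′ ∣ ≡ k → T ⊆ X → T′ ⊆ X →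
                      MeetOnlyIn v T T′ → Heavy (r + j * k) T → Heavy (r + j * k) T′ →
                      F ∈ₗ edges H → ∣ T ∩ F ∣ ≤ j → k ≤ ∣ F ∩ X ∣
  edge-meets-kernel j {T} {F = F} ∣T∣≡k ∣T′∣≡k T⊆X T′⊆X meet heavy heavy′ F∈H T∩F≤j
    with heavy⇒transversal (m≤m+n r (j * k)) heavy F∈H
  ... | a , a∈ with x∈p∩q⁻ F T a∈
  edge-meets-kernel zero ∣T∣≡k ∣T′∣≡k T⊆X T′⊆X meet heavy heavy′ F∈H T∩F≤0
    | a , a∈ | a∈F , a∈T = contradiction T∩F≤0 (<⇒≱ (∈⇒∣∣>0 (x∈p∩q⁺ (a∈T , a∈F))))
  edge-meets-kernel (suc j) {T} {T′} {v} {X} {F} ∣T∣≡k ∣T′∣≡k T⊆X T′⊆X meet heavy heavy′ F∈H T∩F≤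
    | a , a∈ | a∈F , a∈T = helper
    where
    m : ℕ
    m = r + j * k

    -- A round shifts `T′` and then T once each, and a shift costs k. The term `j * k` pays for j
    -- rounds, and the remaining r keeps the sets transversal.
    shift-level : r + (k + j * k) ≡ m + k
    shift-level = trans (cong (r +_) (+-comm k (j * k))) (sym (+-assoc r (j * k) k))

    S′ : Subset n
    S′ = T′ - v ⊕ a

    ∣S′∣≡k : ∣ S′ ∣ ≡ k
    ∣S′∣≡k = trans (∣swap∣ (∈ʳ meet) (meetOnlyIn-∉ (meetOnlyIn-sym meet) a∈T)) ∣T′∣≡k

    S′⊆X : S′ ⊆ X
    S′⊆X = exchange-⊆ T′⊆X (T⊆X a∈T)

    heavy-S′ : Heavy m S′
    heavy-S′ = heavy-shift ∣T∣≡k (heavy⇒transversal (m≤m+n r _) heavy) (meetOnlyIn-sym meet) a∈T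
                 (subst (λ l → Heavy l T′) shift-level heavy′)

    meet-S′ : MeetOnlyIn a T S′
    meet-S′ = meetOnlyIn-sym (meetOnlyIn-exchange (meetOnlyIn-sym meet) a∈T)

    helper : k ≤ ∣ F ∩ X ∣
    helper with S′ ⊆? F
    ... | yes S′⊆F = ≤-trans (≤-reflexive (sym ∣S′∣≡k))
                       (p⊆q⇒∣p∣≤∣q∣ λ x∈ → x∈p∩q⁺ (S′⊆F x∈ , S′⊆X x∈))
    ... | no  S′⊈F with ⊈⇒∃∉ S′⊈F
    ...   | b , b∈S′ , b∉F =
      edge-meets-kernel j {T = T - a ⊕ b}
        (trans (∣swap∣ a∈T (meetOnlyIn-∉ meet-S′ b∈S′)) ∣T∣≡k) ∣S′∣≡k
        (exchange-⊆ T⊆X (S′⊆X b∈S′)) S′⊆X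
        (meetOnlyIn-exchange meet-S′ b∈S′)
        (heavy-shift ∣S′∣≡k (heavy⇒transversal (m≤m+n r _) heavy-S′) meet-S′ b∈S′
           (subst (λ l → Heavy l T) shift-level heavy))
        heavy-S′ F∈H (s≤s⁻¹ (<-≤-trans (∣exchange-∩∣< a∈T a∈F b∉F) T∩F≤))

  -- Bounding the number of edges by branching.

  Coverable : Subset n → ℕ → Set
  Coverable S b = ∃[ L ] length L ≤ b × (∀ {E} → E ∈ₗ edges H → S ⊆ E → E ∈ₗ L)

  coverable-concat : ∀ {S b} (ys : List (Fin n)) → (∀ {y} → y ∈ₗ ys → Coverable (S ⊕ y) b) →
    ∃[ L ] length L ≤ length ys * b ×
           (∀ {E y} → E ∈ₗ edges H → S ⊆ E → y ∈ₗ ys → y ∈ E → E ∈ₗ L)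
  coverable-concat []       cover = [] , z≤n , λ _ _ ()
  coverable-concat (y ∷ ys) cover with cover (here refl) | coverable-concat ys (cover ∘ there)
  ... | K , K≤b , K-covers | L , L≤ , L-covers =
    K ++ L , ≤-trans (≤-reflexive (length-++ K)) (+-mono-≤ K≤b L≤) , λ where
      E∈H S⊆E (here refl) y∈E → ∈-++⁺ˡ (K-covers E∈H (⊕-least S⊆E y∈E))
      E∈H S⊆E (there y∈)  y∈E → ∈-++⁺ʳ K (L-covers E∈H S⊆E y∈ y∈E)

  -- Every edge containing S meets the blocker Y in a vertex outside S, so it suffices to branch
  -- over at most c such vertices.
  coverable-branch : ∀ {S b c} → Blocked c S → (∀ {y} → y ∉ S → Coverable (S ⊕ y) b) →
                     Coverable S (c * b)
  coverable-branch {S} {b} {c} (Y , Y≤c , blocked) cover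
    with coverable-concat (elements (Y ∩ ∁ S))
           (λ y∈ → cover (x∈∁p⇒x∉p (proj₂ (x∈p∩q⁻ Y (∁ S) (∈-elements⁻ (Y ∩ ∁ S) y∈)))))
  ... | L , L≤ , L-covers = L , length≤ , covers
    where
    length≤ : length L ≤ c * b
    length≤ = ≤-trans L≤ (*-monoˡ-≤ b (≤-trans (≤-reflexive (length-elements (Y ∩ ∁ S)))
                (≤-trans (∣p∩q∣≤∣p∣ Y (∁ S)) Y≤c)))

    covers : ∀ {E} → E ∈ₗ edges H → S ⊆ E → E ∈ₗ L
    covers {E} E∈H S⊆E with ⊈⇒∃∉ {q = E ∩ Y} {p = S} (λ E∩Y⊆S → blocked (E , E∈H , S⊆E , E∩Y⊆S))
    ... | y , y∈E∩Y , y∉S = let y∈E , y∈Y = x∈p∩q⁻ E Y y∈E∩Y in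
      L-covers E∈H S⊆E (∈-elements⁺ (x∈p∩q⁺ (y∈Y , x∉p⇒x∈∁p y∉S))) y∈E

  -- A set with fewer than r vertices is blocked by the whole vertex set, so each branching costs a
  -- factor n.
  coverable-trivially : ∀ j {S} → ∣ S ∣ + j ≡ r → Coverable S (n ^ j)
  coverable-trivially zero {S} eq = (S ∷ []) , ≤-refl , λ E∈H S⊆E →
    here (sym (⊆∧∣∣≡⇒≡ S⊆E (trans (sym (+-identityʳ ∣ S ∣)) (trans eq (sym (uniform H E∈H))))))
  coverable-trivially (suc j) {S} eq =
    coverable-branch {c = n} (⊤ , ∣p∣≤n ⊤ , blocked)
      (λ y∉S → coverable-trivially j (∣⊕∣+ eq y∉S))
    where
    blocked : ¬ EdgeAvoiding S ⊤
    blocked (E , E∈H , S⊆E , E∩⊤⊆S) = <⇒≱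
      (≤-trans (≤-trans (m≤m+n _ j) (≤-reflexive (sym (+-suc ∣ S ∣ j)))) (≤-reflexive eq))
      (≤-trans (≤-reflexive (sym (uniform H E∈H)))
        (p⊆q⇒∣p∣≤∣q∣ λ x∈E → E∩⊤⊆S (x∈p∩q⁺ (x∈E , ∈⊤))))

  -- Up to size k all sets have blockers of size at most m, so each branching until size k + 1 costs
  -- only m. The factor n is paid for the last j = r - k - 1 vertices alone.
  coverable-blocked : ∀ {m j E} → r ≤ m → E ∈ₗ edges H → suc k + j ≡ r →
                      (∀ {T} → ∣ T ∣ ≡ k → Blocked m T) →
                      ∀ i {S} → ∣ S ∣ + i ≡ suc k → Coverable S (m ^ i * n ^ j)
  coverable-blocked {m} {j} r≤m E∈H k+j≡r blocked zero {S} eq =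
    subst (Coverable S) (sym (+-identityʳ (n ^ j)))
      (coverable-trivially j (trans (cong (_+ j) (trans (sym (+-identityʳ ∣ S ∣)) eq)) k+j≡r))
  coverable-blocked {m} {j} r≤m E∈H k+j≡r blocked (suc i) {S} eq =
    subst (Coverable S) (sym (*-assoc m (m ^ i) (n ^ j)))
      (coverable-branch S-blocked
        (λ y∉S → coverable-blocked r≤m E∈H k+j≡r blocked i (∣⊕∣+ eq y∉S)))
    where
    S-blocked : Blocked m S
    S-blocked with ∣ S ∣ ≟ k
    ... | yes ∣S∣≡k = blocked ∣S∣≡k
    -- Below size k some edge F misses S, and F blocks S: an edge meeting F only inside S would be
    -- disjoint from F.
    ... | no  ∣S∣≢k
      with avoiding-edge (≤∧≢⇒< (s≤s⁻¹ (≤-trans (≤-trans (s≤s (m≤m+n ∣ S ∣ i))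
             (≤-reflexive (sym (+-suc ∣ S ∣ i)))) (≤-reflexive eq))) ∣S∣≢k) _ E∈H ≤-refl
    ...   | F , F∈H , F∩S≡∅ = F , ≤-trans (≤-reflexive (uniform H F∈H)) r≤m ,
      λ (G , G∈H , _ , G∩F⊆S) → let x , x∈ = intersecting G∈H F∈H in
        F∩S≡∅ (x , x∈p∩q⁺ (proj₂ (x∈p∩q⁻ G F x∈) , G∩F⊆S x∈))

  heavy-exists : ∀ {m j E} → r ≤ m → E ∈ₗ edges H → suc k + j ≡ r →
                 m ^ suc k * n ^ j < numEdges H → ∃[ T ] ∣ T ∣ ≡ k × Heavy m T
  heavy-exists {m} {j} r≤m E∈H k+j≡r many
    with anySubset? (λ T → (∣ T ∣ ≟ k) ×-dec heavy? T)
    where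
    heavy? : ∀ T → Dec (Heavy m T)
    heavy? T with heavy⊎blocked m T
    ... | inj₁ heavy               = yes heavy
    ... | inj₂ (Y , Y≤m , blocked) = no λ heavy → blocked (heavy Y Y≤m)
  ... | yes found = found
  ... | no  none
    with coverable-blocked r≤m E∈H k+j≡r blocked (suc k) {⊥} (cong (_+ suc k) (∣⊥∣≡0 n))
    where
    blocked : ∀ {T} → ∣ T ∣ ≡ k → Blocked m T
    blocked {T} ∣T∣≡k with heavy⊎blocked m T
    ... | inj₁ heavy = contradiction (T , ∣T∣≡k , heavy) none
    ... | inj₂ b     = b
  ... | L , L≤ , L-covers = contradiction
    (≤-trans (unique⊆⇒length≤ (unique H) λ E∈ → L-covers E∈ (⊆-min _)) L≤) (<⇒≱ many)

  -- Locating the kernel.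

  contained-in-kernelSystem : ∀ {T} → ∣ T ∣ ≡ k → Heavy (level r (r + k * k) k) T →
    ∃[ X ] ∣ X ∣ + 1 ≡ k + k × (∀ {F} → F ∈ₗ edges H → k ≤ ∣ F ∩ X ∣)
  contained-in-kernelSystem {T} ∣T∣≡k heavy
    -- The descent starts with T paired with itself, so the intersection has k vertices and a budget
    -- of k exchange steps suffices.
    with heavy-meetingOnce (m≤m+n r (k * k)) ∣T∣≡k heavy-T k ∣T∣≡k
           (≤-trans (∣p∩q∣≤∣p∣ T T) (≤-reflexive ∣T∣≡k)) heavy
    where
    heavy-T : Heavy (r + k * k) T
    heavy-T = heavy-anti (m≤level r (r + k * k) k) heavy
  ... | S , v , ∣S∣≡k , heavy-S , meet = S ∪ T , size , λ {F} F∈H →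
    edge-meets-kernel k ∣S∣≡k ∣T∣≡k (p⊆p∪q T) (q⊆p∪q S T) meet heavy-S
      (heavy-anti (m≤level r (r + k * k) k) heavy) F∈H
      (≤-trans (∣p∩q∣≤∣p∣ S F) (≤-reflexive ∣S∣≡k))
    where
    open ≡-Reasoning
    S∩T≡⁅v⁆ : S ∩ T ≡ ⁅ v ⁆
    S∩T≡⁅v⁆ = ⊆-antisym
      (λ x∈ → let x∈S , x∈T = x∈p∩q⁻ S T x∈ in
        subst (_∈ ⁅ v ⁆) (sym (only meet x∈S x∈T)) (x∈⁅x⁆ v))
      (λ x∈ → subst (_∈ S ∩ T) (sym (x∈⁅y⁆⇒x≡y v x∈)) (x∈p∩q⁺ (∈ˡ meet , ∈ʳ meet)))

    size : ∣ S ∪ T ∣ + 1 ≡ k + k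
    size = begin
      ∣ S ∪ T ∣ + 1           ≡⟨ cong (∣ S ∪ T ∣ +_) (trans (cong ∣_∣ S∩T≡⁅v⁆) (∣⁅x⁆∣≡1 v)) ⟨
      ∣ S ∪ T ∣ + ∣ S ∩ T ∣   ≡⟨ ∣∪∣+∣∩∣ S T ⟩
      ∣ S ∣ + ∣ T ∣           ≡⟨ cong₂ _+_ ∣S∣≡k ∣T∣≡k ⟩
      k + k                   ∎

-- Enumerating and counting supersets.

unique-map-on : ∀ {A B : Set} {f : A → B} {xs} →
                (∀ {x y} → x ∈ₗ xs → y ∈ₗ xs → f x ≡ f y → x ≡ y) →
                Unique xs → Unique (map f xs)
unique-map-on inj []           = []
unique-map-on {f = f} {xs = x ∷ xs} inj (x∉xs ∷ uxs) =
  All.tabulate fx≢ ∷ unique-map-on (λ x∈ y∈ → inj (there x∈) (there y∈)) uxs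
  where
  fx≢ : ∀ {z} → z ∈ₗ map f xs → f x ≢ z
  fx≢ z∈ fx≡z with ∈-map⁻ f z∈
  ... | y , y∈ , refl = All.lookup x∉xs y∈ (inj (here refl) (there y∈) fx≡z)

-- Recursion along the vertices makes the length follow Pascal's rule. `supersets ⊥ r` enumerates
-- all r-sets.
supersets : Subset n → ℕ → List (Subset n)
supersets []            zero    = [] ∷ []
supersets []            (suc j) = []
supersets (inside  ∷ p) j       = map (inside ∷_) (supersets p j)
supersets (outside ∷ p) zero    = map (outside ∷_) (supersets p zero)
supersets (outside ∷ p) (suc j) =
  map (outside ∷_) (supersets p (suc j)) ++ map (inside ∷_) (supersets p j)

∈-supersets⁻ : ∀ (p : Subset n) j → E ∈ₗ supersets p j → p ⊆ E × ∣ E ∣ ≡ ∣ p ∣ + j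
∈-supersets⁻ []            zero    (here refl) = ⊆-refl , refl
∈-supersets⁻ (inside  ∷ p) j       E∈ with ∈-map⁻ (inside ∷_) E∈
... | _ , F∈ , refl = let p⊆F , eq = ∈-supersets⁻ p j F∈ in s⊆s p⊆F , cong suc eq
∈-supersets⁻ (outside ∷ p) zero    E∈ with ∈-map⁻ (outside ∷_) E∈
... | _ , F∈ , refl = let p⊆F , eq = ∈-supersets⁻ p zero F∈ in s⊆s p⊆F , eq
∈-supersets⁻ (outside ∷ p) (suc j) E∈ with ∈-++⁻ (map (outside ∷_) (supersets p (suc j))) E∈
... | inj₁ E∈ˡ with ∈-map⁻ (outside ∷_) E∈ˡ
...   | _ , F∈ , refl = let p⊆F , eq = ∈-supersets⁻ p (suc j) F∈ in s⊆s p⊆F , eq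
∈-supersets⁻ (outside ∷ p) (suc j) E∈ | inj₂ E∈ʳ with ∈-map⁻ (inside ∷_) E∈ʳ
...   | _ , F∈ , refl = let p⊆F , eq = ∈-supersets⁻ p j F∈ in
  out⊆ p⊆F , trans (cong suc eq) (sym (+-suc ∣ p ∣ j))

∈-supersets⁺ : ∀ (p : Subset n) j → p ⊆ E → ∣ E ∣ ≡ ∣ p ∣ + j → E ∈ₗ supersets p j
∈-supersets⁺ {E = []}          []            zero    p⊆E eq = here refl
∈-supersets⁺ {E = inside ∷ E}  (inside ∷ p)  j       p⊆E eq =
  ∈-map⁺ (inside ∷_) (∈-supersets⁺ p j (drop-∷-⊆ p⊆E) (cong pred eq))
∈-supersets⁺ {E = outside ∷ E} (inside ∷ p)  j       p⊆E eq = contradiction (p⊆E here) λ ()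
∈-supersets⁺ {E = outside ∷ E} (outside ∷ p) zero    p⊆E eq =
  ∈-map⁺ (outside ∷_) (∈-supersets⁺ p zero (drop-∷-⊆ p⊆E) eq)
∈-supersets⁺ {E = inside ∷ E}  (outside ∷ p) zero    p⊆E eq = contradiction
  (p⊆q⇒∣p∣≤∣q∣ (drop-∷-⊆ p⊆E))
  (<⇒≱ (≤-reflexive (trans eq (+-identityʳ ∣ p ∣))))
∈-supersets⁺ {E = outside ∷ E} (outside ∷ p) (suc j) p⊆E eq =
  ∈-++⁺ˡ (∈-map⁺ (outside ∷_) (∈-supersets⁺ p (suc j) (drop-∷-⊆ p⊆E) eq))
∈-supersets⁺ {E = inside ∷ E}  (outside ∷ p) (suc j) p⊆E eq =
  ∈-++⁺ʳ (map (outside ∷_) (supersets p (suc j)))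
    (∈-map⁺ (inside ∷_) (∈-supersets⁺ p j (drop-∷-⊆ p⊆E) (cong pred (trans eq (+-suc ∣ p ∣ j)))))

supersets-unique : ∀ (p : Subset n) j → Unique (supersets p j)
supersets-unique []            zero    = [] ∷ []
supersets-unique []            (suc j) = []
supersets-unique (inside  ∷ p) j       = Unique.map⁺ ∷-injectiveʳ (supersets-unique p j)
supersets-unique (outside ∷ p) zero    = Unique.map⁺ ∷-injectiveʳ (supersets-unique p zero)
supersets-unique (outside ∷ p) (suc j) = Unique.++⁺
  (Unique.map⁺ ∷-injectiveʳ (supersets-unique p (suc j)))
  (Unique.map⁺ ∷-injectiveʳ (supersets-unique p j))
  disjoint
  where
  disjoint : ∀ {E} → ¬ (E ∈ₗ map (outside ∷_) (supersets p (suc j)) ×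
                        E ∈ₗ map (inside ∷_) (supersets p j))
  disjoint (E∈ˡ , E∈ʳ) with ∈-map⁻ (outside ∷_) E∈ˡ | ∈-map⁻ (inside ∷_) E∈ʳ
  ... | _ , _ , refl | _ , _ , ()

length-supersets : ∀ (p : Subset n) j → length (supersets p j) ≡ ∣ ∁ p ∣ C j
length-supersets []            zero    = refl
length-supersets []            (suc j) = sym (k>n⇒nCk≡0 {0} {suc j} z<s)
length-supersets (inside  ∷ p) j       = trans (length-map _ (supersets p j)) (length-supersets p j)
length-supersets (outside ∷ p) zero    =
  trans (length-map _ (supersets p zero)) (length-supersets p zero)
length-supersets (outside ∷ p) (suc j) = begin
  length (map (outside ∷_) (supersets p (suc j)) ++ map (inside ∷_) (supersets p j))
    ≡⟨ length-++ (map (outside ∷_) (supersets p (suc j))) ⟩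
  length (map (outside ∷_) (supersets p (suc j))) + length (map (inside ∷_) (supersets p j))
    ≡⟨ cong₂ _+_ (trans (length-map _ (supersets p (suc j))) (length-supersets p (suc j)))
                 (trans (length-map _ (supersets p j)) (length-supersets p j)) ⟩
  ∣ ∁ p ∣ C suc j + ∣ ∁ p ∣ C j
    ≡⟨ +-comm (∣ ∁ p ∣ C suc j) (∣ ∁ p ∣ C j) ⟩
  ∣ ∁ p ∣ C j + ∣ ∁ p ∣ C suc j
    ≡⟨ nCk+nC[k+1]≡[n+1]C[k+1] ∣ ∁ p ∣ j ⟩
  suc ∣ ∁ p ∣ C suc j
    ∎
  where open ≡-Reasoning

C-step-≤ : ∀ m j → m C j ≤ suc m C j
C-step-≤ m zero    = ≤-refl
C-step-≤ m (suc j) = ≤-trans (m≤n+m _ (m C j)) (≤-reflexive (nCk+nC[k+1]≡[n+1]C[k+1] m j))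

C-mono-+ : ∀ q m j → m C j ≤ (q + m) C j
C-mono-+ zero    m j = ≤-refl
C-mono-+ (suc q) m j = ≤-trans (C-mono-+ q m j) (C-step-≤ (q + m) j)

-- Pascal's rule applied q times splits off the q terms `(i + m) C j` with i < q, each at least
-- `m C j`.
*C≤[+]C[1+] : ∀ q m j → q * (m C j) ≤ (q + m) C suc j
*C≤[+]C[1+] zero    m j = z≤n
*C≤[+]C[1+] (suc q) m j = ≤-trans (+-mono-≤ (C-mono-+ q m j) (*C≤[+]C[1+] q m j))
  (≤-reflexive (nCk+nC[k+1]≡[n+1]C[k+1] (q + m) j))

-- Combinatorially, one element can be chosen from each of j disjoint blocks of size q.
^≤C : ∀ j q → q ^ j ≤ (j * q) C j
^≤C zero    q = ≤-refl
^≤C (suc j) q = ≤-trans (*-monoʳ-≤ q (^≤C j q)) (*C≤[+]C[1+] q (j * q) j)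

^≤length-supersets : ∀ (p : Subset n) j q → j * q ≤ ∣ ∁ p ∣ → q ^ j ≤ length (supersets p j)
^≤length-supersets p j q jq≤ with m≤n⇒∃[o]m+o≡n jq≤
... | o , eq = begin
  q ^ j                    ≤⟨ ^≤C j q ⟩
  (j * q) C j              ≤⟨ C-mono-+ o (j * q) j ⟩
  (o + j * q) C j          ≡⟨ cong (_C j) (trans (+-comm o (j * q)) eq) ⟩
  ∣ ∁ p ∣ C j              ≡⟨ length-supersets p j ⟨
  length (supersets p j)   ∎
  where open ≤-Reasoning

enlarge : ∀ j (p : Subset n) → ∣ p ∣ + j ≤ n → ∃[ q ] p ⊆ q × ∣ q ∣ ≡ ∣ p ∣ + j
enlarge zero    p ≤n = p , ⊆-refl , sym (+-identityʳ ∣ p ∣)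
enlarge {n} (suc j) p ≤n with enlarge j p (≤-trans (+-monoʳ-≤ ∣ p ∣ (n≤1+n j)) ≤n)
... | q , p⊆q , ∣q∣≡
  with ∣∣<⇒∃∉ {p = q} {q = ⊤} (≤-trans (≤-reflexive (trans (cong suc ∣q∣≡) (sym (+-suc ∣ p ∣ j))))
         (≤-trans ≤n (≤-reflexive (sym (∣⊤∣≡n n)))))
...   | w , _ , w∉q = q ⊕ w , (λ x∈ → ∈-⊕ˡ (p⊆q x∈)) ,
  trans (∣⊕∣ q w∉q) (trans (cong suc ∣q∣≡) (sym (+-suc ∣ p ∣ j)))

-- Passing between `δ⁺` and codegree bounds.

-- The empty hypergraph has `δ⁺` equal to 0, so k ≥ 1 forces an edge to exist.
δ⁺≥⇒positiveCodegrees≥ : ∀ (H : UniformHypergraph n r) {k} → 1 ≤ k → δ⁺ H ≥ k →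
                         ∃[ E ] E ∈ₗ edges H × PositiveCodegrees≥ H k
δ⁺≥⇒positiveCodegrees≥ H {k} 1≤k δ≥k with edges H in eq
... | []    = contradiction (≤-trans 1≤k (≤-trans δ≥k (≤-reflexive (proj₁ (δ⁺-correct H) eq)))) λ ()
... | E ∷ _ = E , here refl , λ S size covered → ≤-trans δ≥k
  (subst (λ es → δ⁺ H ≤ length (filter (S ⊆?_) es)) eq
    (proj₁ (proj₂ (δ⁺-correct H) nonempty) S size
      (subst (λ es → ∃[ E ] E ∈ₗ es × S ⊆ E) (sym eq) covered)))
  where
  nonempty : edges H ≢ []
  nonempty empty with trans (sym eq) empty
  ... | ()

positiveCodegrees≥⇒δ⁺≥ : ∀ (H : UniformHypergraph n r) {k} → E ∈ₗ edges H →
                         PositiveCodegrees≥ H k → δ⁺ H ≥ k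
positiveCodegrees≥⇒δ⁺≥ H E∈H codegrees = proj₂ (proj₂ (δ⁺-correct H) nonempty) codegrees
  where
  nonempty : edges H ≢ []
  nonempty empty with subst (_ ∈ₗ_) empty E∈H
  ... | ()

-- Kernel systems as competitors.

module _ {n : ℕ} (r k : ℕ) (X : Subset n) where

  kernelSystem : UniformHypergraph n r
  kernelSystem = record
    { edges   = filter (λ E → k ≤? ∣ E ∩ X ∣) (supersets ⊥ r)
    ; unique  = Unique.filter⁺ (λ E → k ≤? ∣ E ∩ X ∣) (supersets-unique ⊥ r)
    ; uniform = λ E∈ → trans
        (proj₂ (∈-supersets⁻ ⊥ r (proj₁ (∈-filter⁻ (λ E → k ≤? ∣ E ∩ X ∣) E∈))))
        (cong (_+ r) (∣⊥∣≡0 n))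
    }

  ∈-kernelSystem⁺ : ∀ {E} → ∣ E ∣ ≡ r → k ≤ ∣ E ∩ X ∣ → E ∈ₗ edges kernelSystem
  ∈-kernelSystem⁺ ∣E∣≡r k≤ = ∈-filter⁺ (λ E → k ≤? ∣ E ∩ X ∣)
    (∈-supersets⁺ ⊥ r (⊆-min _) (trans ∣E∣≡r (cong (_+ r) (sym (∣⊥∣≡0 n))))) k≤

  ∈-kernelSystem⁻ : ∀ {E} → E ∈ₗ edges kernelSystem → k ≤ ∣ E ∩ X ∣
  ∈-kernelSystem⁻ E∈ = proj₂ (∈-filter⁻ (λ E → k ≤? ∣ E ∩ X ∣) {xs = supersets ⊥ r} E∈)

  -- Two disjoint traces of size at least k would need 2k vertices of X, which has 2k - 1.
  kernelSystem-intersecting : ∣ X ∣ + 1 ≡ k + k → Intersecting kernelSystem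
  kernelSystem-intersecting ∣X∣ {E} {F} E∈ F∈ with nonempty? (E ∩ F)
  ... | yes meet  = meet
  ... | no  empty = contradiction (begin-strict
    ∣ X ∣                                                        <⟨ m<m+n ∣ X ∣ z<s ⟩
    ∣ X ∣ + 1                                                    ≡⟨ ∣X∣ ⟩
    k + k                                                        ≤⟨ +-mono-≤ (∈-kernelSystem⁻ E∈) (∈-kernelSystem⁻ F∈) ⟩
    ∣ E ∩ X ∣ + ∣ F ∩ X ∣                                        ≡⟨ ∣∪∣+∣∩∣ (E ∩ X) (F ∩ X) ⟨
    ∣ (E ∩ X) ∪ (F ∩ X) ∣ + ∣ (E ∩ X) ∩ (F ∩ X) ∣                ≡⟨ cong (λ p → ∣ (E ∩ X) ∪ (F ∩ X) ∣ + ∣ p ∣) disjoint ⟩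
    ∣ (E ∩ X) ∪ (F ∩ X) ∣ + ∣ ⊥ {n = n} ∣                        ≡⟨ cong (∣ (E ∩ X) ∪ (F ∩ X) ∣ +_) (∣⊥∣≡0 n) ⟩
    ∣ (E ∩ X) ∪ (F ∩ X) ∣ + 0                                    ≡⟨ +-identityʳ _ ⟩
    ∣ (E ∩ X) ∪ (F ∩ X) ∣                                        ≤⟨ p⊆q⇒∣p∣≤∣q∣ ⊆X ⟩
    ∣ X ∣                                                        ∎) (<-irrefl refl)
    where
    open ≤-Reasoning
    disjoint : (E ∩ X) ∩ (F ∩ X) ≡ ⊥
    disjoint = Empty-unique λ (x , x∈) →
      let x∈E∩X , x∈F∩X = x∈p∩q⁻ (E ∩ X) (F ∩ X) x∈
      in empty (x , x∈p∩q⁺ (p∩q⊆p E X x∈E∩X , p∩q⊆p F X x∈F∩X))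

    ⊆X : (E ∩ X) ∪ (F ∩ X) ⊆ X
    ⊆X x∈ = [ p∩q⊆q E X , p∩q⊆q F X ]′ (x∈p∪q⁻ (E ∩ X) (F ∩ X) x∈)

  kernelSystem-codegree : ∀ {S} → suc ∣ S ∣ ≡ r → ∀ W →
    (∀ {w} → w ∈ W → w ∉ S × k ≤ ∣ (S ⊕ w) ∩ X ∣) → ∣ W ∣ ≤ codegree kernelSystem S
  kernelSystem-codegree {S} ∣S∣ W extends = begin
    ∣ W ∣                               ≡⟨ length-elements W ⟨
    length (elements W)                 ≡⟨ length-map (S ⊕_) (elements W) ⟨
    length (map (S ⊕_) (elements W))    ≤⟨ unique⊆⇒length≤ (unique-map-on injective (elements-unique W)) sub ⟩
    codegree kernelSystem S             ∎
    where
    open ≤-Reasoning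
    injective : ∀ {x y} → x ∈ₗ elements W → y ∈ₗ elements W → S ⊕ x ≡ S ⊕ y → x ≡ y
    injective {x} x∈ _ eq with ∈-⊕⁻ (subst (x ∈_) eq (∈-⊕ʳ S x))
    ... | inj₁ x∈S = contradiction x∈S (proj₁ (extends (∈-elements⁻ W x∈)))
    ... | inj₂ x≡y = x≡y

    sub : ∀ {F} → F ∈ₗ map (S ⊕_) (elements W) → F ∈ₗ filter (S ⊆?_) (edges kernelSystem)
    sub F∈ with ∈-map⁻ (S ⊕_) F∈
    ... | w , w∈ , refl with extends (∈-elements⁻ W w∈)
    ...   | w∉S , k≤ = ∈-filter⁺ (S ⊆?_) (∈-kernelSystem⁺ (trans (∣⊕∣ S w∉S) ∣S∣) k≤) ∈-⊕ˡ

  -- If S already has k vertices in X, any of the at least k vertices outside S completes it.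
  -- Otherwise S has exactly k - 1 vertices in X, because it extends to an edge, and the k remaining
  -- vertices of X each complete it.
  kernelSystem-positiveCodegrees≥ : 1 ≤ r → r ∸ 1 + k ≤ n → ∣ X ∣ + 1 ≡ k + k →
                                    PositiveCodegrees≥ kernelSystem k
  kernelSystem-positiveCodegrees≥ 1≤r r-1+k≤n ∣X∣ S ∣S∣≡r-1 (E , E∈ , S⊆E)
    with k ≤? ∣ S ∩ X ∣
  ... | yes k≤S∩X = ≤-trans k≤∁S (kernelSystem-codegree 1+∣S∣≡r (∁ S) λ {w} w∈ →
    x∈∁p⇒x∉p w∈ , ≤-trans k≤S∩X (p⊆q⇒∣p∣≤∣q∣ {q = (S ⊕ w) ∩ X} λ x∈ →
      let x∈S , x∈X = x∈p∩q⁻ S X x∈ in x∈p∩q⁺ (∈-⊕ˡ x∈S , x∈X)))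
    where
    1+∣S∣≡r : suc ∣ S ∣ ≡ r
    1+∣S∣≡r = trans (cong suc ∣S∣≡r-1) (m+[n∸m]≡n 1≤r)

    k≤∁S : k ≤ ∣ ∁ S ∣
    k≤∁S = begin
      k                ≡⟨ m+n∸m≡n (r ∸ 1) k ⟨
      r ∸ 1 + k ∸ (r ∸ 1) ≤⟨ ∸-monoˡ-≤ (r ∸ 1) r-1+k≤n ⟩
      n ∸ (r ∸ 1)      ≡⟨ cong (n ∸_) ∣S∣≡r-1 ⟨
      n ∸ ∣ S ∣        ≡⟨ ∣∁p∣≡n∸∣p∣ S ⟨
      ∣ ∁ S ∣          ∎
      where open ≤-Reasoning
  ... | no k≰S∩X = ≤-trans k≤X∖S (kernelSystem-codegree 1+∣S∣≡r (X ∩ ∁ S) λ w∈ →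
    let w∈X , w∈∁S = x∈p∩q⁻ X (∁ S) w∈
        w∉S = x∈∁p⇒x∉p w∈∁S in w∉S , extend w∈X w∉S)
    where
    open ≤-Reasoning
    1+∣S∣≡r : suc ∣ S ∣ ≡ r
    1+∣S∣≡r = trans (cong suc ∣S∣≡r-1) (m+[n∸m]≡n 1≤r)

    k≤1+S∩X : k ≤ suc ∣ S ∩ X ∣
    k≤1+S∩X with ∣∣<⇒∃∉ {p = S} {q = E} (≤-reflexive (trans 1+∣S∣≡r (sym (uniform kernelSystem E∈))))
    ... | e , e∈E , e∉S
      with ⊆∧∣∣≡⇒≡ (⊕-least S⊆E e∈E)
             (trans (∣⊕∣ S e∉S) (trans 1+∣S∣≡r (sym (uniform kernelSystem E∈))))
    ...   | refl = begin
      k                          ≤⟨ ∈-kernelSystem⁻ E∈ ⟩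
      ∣ (S ⊕ e) ∩ X ∣            ≤⟨ p⊆q⇒∣p∣≤∣q∣ sub ⟩
      ∣ (S ∩ X) ⊕ e ∣            ≡⟨ ∣⊕∣ (S ∩ X) (λ e∈ → e∉S (p∩q⊆p S X e∈)) ⟩
      suc ∣ S ∩ X ∣              ∎
      where
      sub : (S ⊕ e) ∩ X ⊆ (S ∩ X) ⊕ e
      sub x∈ with x∈p∩q⁻ (S ⊕ e) X x∈
      ... | x∈⊕ , x∈X with ∈-⊕⁻ x∈⊕
      ...   | inj₁ x∈S  = ∈-⊕ˡ (x∈p∩q⁺ (x∈S , x∈X))
      ...   | inj₂ refl = ∈-⊕ʳ (S ∩ X) e

    extend : ∀ {w} → w ∈ X → w ∉ S → k ≤ ∣ (S ⊕ w) ∩ X ∣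
    extend {w} w∈X w∉S = begin
      k                          ≤⟨ k≤1+S∩X ⟩
      suc ∣ S ∩ X ∣              ≡⟨ ∣⊕∣ (S ∩ X) (λ w∈ → w∉S (p∩q⊆p S X w∈)) ⟨
      ∣ (S ∩ X) ⊕ w ∣            ≤⟨ p⊆q⇒∣p∣≤∣q∣ (⊕-least
                                     (λ x∈ → let x∈S , x∈X = x∈p∩q⁻ S X x∈ in x∈p∩q⁺ (∈-⊕ˡ x∈S , x∈X))
                                     (x∈p∩q⁺ (∈-⊕ʳ S w , w∈X))) ⟩
      ∣ (S ⊕ w) ∩ X ∣            ∎

    k≤X∖S : k ≤ ∣ X ∩ ∁ S ∣
    k≤X∖S = +-cancelˡ-≤ k _ _ (begin
      k + k                              ≡⟨ ∣X∣ ⟨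
      ∣ X ∣ + 1                          ≡⟨ +-comm ∣ X ∣ 1 ⟩
      suc ∣ X ∣                          ≤⟨ s≤s (p⊆q⇒∣p∣≤∣q∣ split) ⟩
      suc ∣ (S ∩ X) ∪ (X ∩ ∁ S) ∣        ≤⟨ s≤s (∣∪∣≤ (S ∩ X) (X ∩ ∁ S)) ⟩
      suc ∣ S ∩ X ∣ + ∣ X ∩ ∁ S ∣        ≤⟨ +-monoˡ-≤ _ (≰⇒> k≰S∩X) ⟩
      k + ∣ X ∩ ∁ S ∣                    ∎)
      where
      split : X ⊆ (S ∩ X) ∪ (X ∩ ∁ S)
      split {x} x∈X with x ∈? S
      ... | yes x∈S = p⊆p∪q _ (x∈p∩q⁺ (x∈S , x∈X))
      ... | no  x∉S = q⊆p∪q (S ∩ X) _ (x∈p∩q⁺ (x∈X , x∉p⇒x∈∁p x∉S))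

  kernelSystem-δ⁺≥ : ∀ {E} → 1 ≤ r → r ∸ 1 + k ≤ n → ∣ X ∣ + 1 ≡ k + k →
                     E ∈ₗ edges kernelSystem → δ⁺ kernelSystem ≥ k
  kernelSystem-δ⁺≥ 1≤r r-1+k≤n ∣X∣ E∈ = positiveCodegrees≥⇒δ⁺≥ kernelSystem E∈
    (kernelSystem-positiveCodegrees≥ 1≤r r-1+k≤n ∣X∣)

-- It is enough to count the edges through one fixed k-set T inside X.
large-kernelSystem : ∀ r k j q → 1 ≤ k → k + j ≡ r → k + k ≤ n → j * q ≤ n ∸ k →
  ∃[ X ] ∣ X ∣ + 1 ≡ k + k × q ^ j ≤ numEdges (kernelSystem {n} r k X)
large-kernelSystem {n} r (suc k) j q _ k+j≡r 2k≤n jq≤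
  with enlarge (suc k) ⊥ (≤-trans (+-monoˡ-≤ (suc k) (≤-reflexive (∣⊥∣≡0 n))) (≤-trans (m≤m+n _ _) 2k≤n))
... | T , _ , ∣T∣≡
  with trans ∣T∣≡ (cong (_+ suc k) (∣⊥∣≡0 n))
... | ∣T∣≡1+k
  -- The kernel parameter is `suc k` here, so k further vertices bring T to size 2 (k + 1) - 1.
  with enlarge k T (≤-trans (+-mono-≤ (≤-reflexive ∣T∣≡1+k) (n≤1+n k)) 2k≤n)
... | X , T⊆X , ∣X∣≡ = X , size , (begin
  q ^ j                              ≤⟨ ^≤length-supersets T j q (≤-trans jq≤ (≤-reflexive (sym ∣∁T∣≡))) ⟩
  length (supersets T j)             ≤⟨ unique⊆⇒length≤ (supersets-unique T j) sub ⟩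
  numEdges (kernelSystem r (suc k) X)      ∎)
  where
  open ≤-Reasoning
  ∣∁T∣≡ : ∣ ∁ T ∣ ≡ n ∸ suc k
  ∣∁T∣≡ = trans (∣∁p∣≡n∸∣p∣ T) (cong (n ∸_) ∣T∣≡1+k)

  size : ∣ X ∣ + 1 ≡ suc k + suc k
  size = trans (cong (_+ 1) (trans ∣X∣≡ (cong (_+ k) ∣T∣≡1+k)))
    (trans (+-assoc (suc k) k 1) (cong (suc k +_) (+-comm k 1)))

  sub : ∀ {E} → E ∈ₗ supersets T j → E ∈ₗ edges (kernelSystem r (suc k) X)
  sub E∈ with ∈-supersets⁻ T j E∈
  ... | T⊆E , ∣E∣≡ = ∈-kernelSystem⁺ r (suc k) X
    (trans ∣E∣≡ (trans (cong (_+ j) ∣T∣≡1+k) k+j≡r))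
    (≤-trans (≤-reflexive (sym ∣T∣≡1+k)) (p⊆q⇒∣p∣≤∣q∣ λ x∈ → x∈p∩q⁺ (T⊆E x∈ , T⊆X x∈)))

-- A kernel-system set E missing from H would make `E ∷ edges H` a duplicate-free list inside the
-- kernel system, longer than `edges H`.
maximal-in-kernelSystem : ∀ {k X} (H : UniformHypergraph n r) → ∣ X ∣ + 1 ≡ k + k →
  (∀ {F} → F ∈ₗ edges H → k ≤ ∣ F ∩ X ∣) → numEdges (kernelSystem r k X) ≤ numEdges H →
  IsKernelSystem k H
maximal-in-kernelSystem {r = r} {k} {X} H ∣X∣ H⊆K K≤H =
  X , size , λ E → mk⇔ (λ E∈H → uniform H E∈H , H⊆K E∈H) (λ (∣E∣≡r , k≤) → complete ∣E∣≡r k≤)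
  where
  size : ∣ X ∣ ≡ 2 * k ∸ 1
  size = trans (sym (m+n∸n≡m ∣ X ∣ 1))
    (cong (_∸ 1) (trans ∣X∣ (cong (k +_) (sym (+-identityʳ k)))))

  complete : ∀ {E} → ∣ E ∣ ≡ r → k ≤ ∣ E ∩ X ∣ → E ∈ₗ edges H
  complete {E} ∣E∣≡r k≤ with any? (≡-dec _≟ᵇ_ E) (edges H)
  ... | yes E∈H = E∈H
  ... | no  E∉H = contradiction K≤H (<⇒≱ (unique⊆⇒length≤ (All.tabulate E≢ ∷ unique H) sub))
    where
    E≢ : ∀ {F} → F ∈ₗ edges H → E ≢ F
    E≢ F∈H refl = E∉H F∈H

    sub : ∀ {F} → F ∈ₗ E ∷ edges H → F ∈ₗ edges (kernelSystem r k X)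
    sub (here refl) = ∈-kernelSystem⁺ r k X ∣E∣≡r k≤
    sub (there F∈H) = ∈-kernelSystem⁺ r k X (uniform H F∈H) (H⊆K F∈H)

-- Constants and the comparison of the two counts.

-- The quotient `n / d` determines n up to a factor 2d, so powers of n can be traded for powers of
-- q.
block-size : ∀ d c n → .{{_ : NonZero d}} → d * suc c ≤ n →
             ∃[ q ] c < q × q * d ≤ n × n ≤ d * (2 * q)
block-size d c n d[1+c]≤n = n / d , c<q , m/n*n≤m n d , n≤
  where
  open ≤-Reasoning
  c<q : c < n / d
  c<q = begin
    suc c               ≡⟨ m*n/n≡m (suc c) d ⟨
    suc c * d / d       ≤⟨ /-monoˡ-≤ d (≤-trans (≤-reflexive (*-comm (suc c) d)) d[1+c]≤n) ⟩
    n / d               ∎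

  n≤ : n ≤ d * (2 * (n / d))
  n≤ = begin
    n                       ≡⟨ m≡m%n+[m/n]*n n d ⟩
    n % d + n / d * d       ≤⟨ +-monoˡ-≤ _ (<⇒≤ (m%n<n n d)) ⟩
    d + n / d * d           ≤⟨ *-monoˡ-≤ d (+-monoˡ-≤ (n / d) (≤-<-trans z≤n c<q)) ⟩
    (n / d + n / d) * d     ≡⟨ *-comm (n / d + n / d) d ⟩
    d * (n / d + n / d)     ≡⟨ cong (λ m → d * (n / d + m)) (+-identityʳ (n / d)) ⟨
    d * (2 * (n / d))       ∎

-- `r + k * k` is what `edge-meets-kernel` consumes in k rounds, and `level` adds room for the k
-- exchange steps before it.
heaviness : ℕ → ℕ → ℕ
heaviness r k = level r (r + k * k) k

-- The first factor is the cost of k + 1 blocked branchings. The second absorbs the ratio 4r in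
-- replacing n by q.
branchingConstant : ℕ → ℕ → ℕ
branchingConstant r k = heaviness r k ^ suc k * (2 * r * 2) ^ r

^-distribʳ-* : ∀ j m n → (m * n) ^ j ≡ m ^ j * n ^ j
^-distribʳ-* zero    m n = refl
^-distribʳ-* (suc j) m n = trans (cong (m * n *_) (^-distribʳ-* j m n))
  ([m*n]*[o*p]≡[m*o]*[n*p] m n (m ^ j) (n ^ j))

-- Substituting n ≤ 4rq leaves at most `branchingConstant r k * q ^ j`, and the constant is smaller
-- than the one additional factor q.
few<many : ∀ {r k n q j} → 1 ≤ r → j ≤ r → n ≤ 2 * r * (2 * q) → branchingConstant r k < q →
           heaviness r k ^ suc k * n ^ j < q ^ suc j
few<many {r@(suc _)} {k} {n} {q} {j} _ j≤r n≤ c<q = begin-strict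
  M * n ^ j                                  ≤⟨ *-monoʳ-≤ M (^-monoˡ-≤ j n≤) ⟩
  M * (2 * r * (2 * q)) ^ j                  ≡⟨ cong (λ m → M * m ^ j) (*-assoc (2 * r) 2 q) ⟨
  M * (2 * r * 2 * q) ^ j                    ≡⟨ cong (M *_) (^-distribʳ-* j (2 * r * 2) q) ⟩
  M * ((2 * r * 2) ^ j * q ^ j)              ≡⟨ *-assoc M ((2 * r * 2) ^ j) (q ^ j) ⟨
  M * (2 * r * 2) ^ j * q ^ j                ≤⟨ *-monoˡ-≤ (q ^ j) (*-monoʳ-≤ M (^-monoʳ-≤ (2 * r * 2) j≤r)) ⟩
  branchingConstant r k * q ^ j                       <⟨ *-monoˡ-< (q ^ j) {{m^n≢0 q j {{>-nonZero (≤-<-trans z≤n c<q)}}}} c<q ⟩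
  q * q ^ j                                  ∎
  where
  open ≤-Reasoning
  M : ℕ
  M = heaviness r k ^ suc k

-- Extremal hypergraphs.

module _ {n r k : ℕ} (1≤k : 1 ≤ k) (n-large : 2 * r * suc (branchingConstant r k) ≤ n)
         (H : UniformHypergraph n r) (intersecting : Intersecting H)
         (codegrees : PositiveCodegrees≥ H k)
         (maximum : (H′ : UniformHypergraph n r) → Intersecting H′ → δ⁺ H′ ≥ k →
                    numEdges H′ ≤ numEdges H) where

  2r≤n : 2 * r ≤ n
  2r≤n = ≤-trans (m≤m*n (2 * r) (suc (branchingConstant r k))) n-large

  r+k≤n : k ≤ r → r + k ≤ n
  r+k≤n k≤r = ≤-trans (+-monoʳ-≤ r (≤-trans k≤r (≤-reflexive (sym (+-identityʳ r))))) 2r≤n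

  -- Maximality applies as soon as the kernel system has an edge, since only then does its codegree
  -- bound give `δ⁺` at least k. An empty one is trivially no larger.
  kernelSystem-≤ : ∀ {X} → k ≤ r → ∣ X ∣ + 1 ≡ k + k → numEdges (kernelSystem r k X) ≤ numEdges H
  kernelSystem-≤ {X} k≤r ∣X∣ with edges (kernelSystem r k X) in eq
  ... | []    = z≤n
  ... | E ∷ _ = ≤-trans (≤-reflexive (sym (cong length eq)))
    (maximum (kernelSystem r k X) (kernelSystem-intersecting r k X ∣X∣)
      (kernelSystem-δ⁺≥ r k X (≤-trans 1≤k k≤r)
        (≤-trans (+-monoˡ-≤ k (m∸n≤m r 1)) (r+k≤n k≤r)) ∣X∣
        (subst (E ∈ₗ_) (sym eq) (here refl))))

  heavy-kernel : ∀ {E} j → k + j ≡ r → (k≤r : k ≤ r) → E ∈ₗ edges H →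
    ∃[ T ] ∣ T ∣ ≡ k × Heavy k≤r H intersecting codegrees (heaviness r k) T
  -- For r = k an edge is itself heavy, as it meets every Y inside itself.
  heavy-kernel {E} zero k≡r k≤r E∈H =
    E , trans (uniform H E∈H) (trans (sym k≡r) (+-identityʳ k)) ,
    λ Y _ → E , E∈H , ⊆-refl , p∩q⊆p E Y
  -- Here r - k = j + 1. By maximality H has at least `q ^ suc j` edges, one power more than
  -- branching allows without a heavy set.
  heavy-kernel (suc j) k+1+j≡r k≤r E∈H
    with block-size (2 * r) (branchingConstant r k) n
           {{m*n≢0 2 r {{_}} {{>-nonZero (≤-trans 1≤k k≤r)}}}} n-large
  ... | q , c<q , q*2r≤n , n≤
    with large-kernelSystem r k (suc j) q 1≤k k+1+j≡r (≤-trans (+-monoˡ-≤ k k≤r) (r+k≤n k≤r)) jq≤n∸k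
    where
    open ≤-Reasoning
    jq≤n∸k : suc j * q ≤ n ∸ k
    jq≤n∸k = m+n≤o⇒m≤o∸n (suc j * q) (begin
      suc j * q + k       ≤⟨ +-mono-≤ (*-monoˡ-≤ q (≤-trans (m≤n+m (suc j) k) (≤-reflexive k+1+j≡r))) k≤r ⟩
      r * q + r           ≤⟨ +-monoʳ-≤ (r * q) (m≤m*n r q {{>-nonZero (≤-<-trans z≤n c<q)}}) ⟩
      r * q + r * q       ≡⟨ *-distribʳ-+ q r r ⟨
      (r + r) * q         ≡⟨ cong (λ m → (r + m) * q) (+-identityʳ r) ⟨
      2 * r * q           ≡⟨ *-comm (2 * r) q ⟩
      q * (2 * r)         ≤⟨ q*2r≤n ⟩
      n                   ∎)
  ... | X , ∣X∣ , q^[1+j]≤ = heavy-exists k≤r H intersecting codegrees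
    (≤-trans (m≤m+n r (k * k)) (m≤level r (r + k * k) k)) E∈H
    (trans (sym (+-suc k j)) k+1+j≡r)
    (<-≤-trans (few<many {k = k} (≤-trans 1≤k k≤r) j≤r n≤ c<q) (≤-trans q^[1+j]≤ (kernelSystem-≤ k≤r ∣X∣)))
    where
    j≤r : j ≤ r
    j≤r = ≤-trans (n≤1+n j) (≤-trans (m≤n+m (suc j) k) (≤-reflexive k+1+j≡r))

  isKernelSystem : ∀ {E} → k ≤ r → E ∈ₗ edges H → IsKernelSystem k H
  isKernelSystem k≤r E∈H with m≤n⇒∃[o]m+o≡n k≤r
  ... | j , k+j≡r with heavy-kernel j k+j≡r k≤r E∈H
  ...   | T , ∣T∣≡k , heavy
    with contained-in-kernelSystem k≤r H intersecting codegrees ∣T∣≡k heavy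
  ...     | X , ∣X∣ , H⊆K = maximal-in-kernelSystem H ∣X∣ H⊆K (kernelSystem-≤ k≤r ∣X∣)

theorem1 : (r k : ℕ) → 1 ≤ k → k ≤ r →
    ∃[ n₀ ] ((n : ℕ) → n ≥ n₀ →
    (H : UniformHypergraph n r) →
    Intersecting H →
    δ⁺ H ≥ k →
    ((H′ : UniformHypergraph n r) → Intersecting H′ → δ⁺ H′ ≥ k → numEdges H′ ≤ numEdges H) →
    IsKernelSystem k H)
theorem1 r k 1≤k k≤r =
  -- This is the threshold at which `block-size` with d = 2r yields a q above
  -- `branchingConstant r k`.
  2 * r * suc (branchingConstant r k) , λ n n≥n₀ H intersecting δ≥k maximum →
    let E , E∈H , codegrees = δ⁺≥⇒positiveCodegrees≥ H 1≤k δ≥k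
    in isKernelSystem 1≤k n≥n₀ H intersecting codegrees maximum k≤r E∈H
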